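{- Let $L$ be the subgroup of $(\mathbb{Z}^d,+)$ spanned by a finite set $X\subseteq\mathbb{Z}^d$ (i.e., the set of finite sums of elements of $X\cup -X$). There exists a $d$-dim linear system $S$ whose set of solutions is exactly $L$ and such that $\max\{\|S\|,\mathrm{lcm}(S)\}\leq d!\cdot\|X\|^d$.
   Context: $\|X\|=\max_{x\in X}\max_i|x(i)|$ (with $\max\emptyset=0$). For a variable $\mathbf{x}$ ranging over $\mathbb{Z}^d$: equality constraints $\langle\alpha,\mathbf{x}\rangle=c$ and inequality constraints $\langle\alpha,\mathbf{x}\rangle\geq c$ ($\alpha\in\mathbb{Z}^d$, $c\in\mathbb{Z}$), and divisibility constraints $\langle\alpha,\mathbf{x}\rangle\equiv c\pmod m$ ($m\in\mathbb{N}_+$, $\alpha\in[0,m-1]^d$, $c\in[0,m-1]$). A $d$-dim linear system is a boolean combination of such constraints; its solution set is the set of $x\in\mathbb{Z}^d$ satisfying it. $\|S\|$ is the least $s\in\mathbb{N}$ with $\max\{\max_i|\alpha(i)|,|c|\}\leq s$ for all equality and inequality constraints of $S$, and $\mathrm{lcm}(S)$ is the least common multiple of the moduli of divisibility constraints in $S$ ($1$ if none).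
   Formalization: The bound is max{1, d!·‖X‖^d} instead of d!·‖X‖^d: the stated bound is 0 when d ≥ 1 and X is empty or {0}, although lcm(S) ≥ 1 always; in all other cases the two bounds coincide. -}

module Defs where

open import Data.Fin.Base using (Fin; toℕ)
open import Data.Integer.Base as ℤ using (ℤ; +_; 0ℤ; ∣_∣)
open import Data.Integer.Divisibility as ℤ∣ using ()
open import Data.Integer.Properties as ℤₚ using ()
open import Data.List.Base as List using (List; []; _∷_; _++_)
open import Data.List.Extrema.Nat using (max)
open import Data.List.Membership.Propositional using (_∈_)
open import Data.List.Relation.Unary.All using (All)
open import Data.Nat.Base using (ℕ; NonZero; _⊔_)
open import Data.Nat.Divisibility as ℕ∣ using ()
open import Data.Nat.LCM using (lcm)
open import Data.Product.Base using (∃-syntax; _×_)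
open import Data.Sum.Base using (_⊎_)
open import Data.Vec.Base as Vec using (Vec)
open import Function.Base using (_∘_)
open import Relation.Binary.PropositionalEquality using (_≡_)
open import Relation.Nullary using (¬_; Dec)
open import Relation.Nullary.Decidable using (¬?; _×-dec_; _⊎-dec_)

infixl 6 _+ᵛ_
infix  8 -ᵛ_
infix  4 _∈Span_ _⊨ᶜ_ _⊨_ _⊨ᶜ?_ _⊨?_
infixr 6 _∧ˢ_
infixr 5 _∨ˢ_

Point : ℕ → Set
Point d = Vec ℤ d

0ᵛ : ∀ {d} → Point d
0ᵛ = Vec.replicate _ 0ℤ

_+ᵛ_ : ∀ {d} → Point d → Point d → Point d
_+ᵛ_ = Vec.zipWith ℤ._+_

-ᵛ_ : ∀ {d} → Point d → Point d
-ᵛ_ = Vec.map (ℤ.-_)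

sumᵛ : ∀ {d} → List (Point d) → Point d
sumᵛ = List.foldr _+ᵛ_ 0ᵛ

⟨_,_⟩ : ∀ {d} → Point d → Point d → ℤ
⟨ α , x ⟩ = Vec.foldr′ ℤ._+_ 0ℤ (Vec.zipWith ℤ._*_ α x)

-- max_i |x(i)|, equal to 0 when d = 0.
‖_‖ᵛ : ∀ {d} → Point d → ℕ
‖ x ‖ᵛ = max 0 (Vec.toList (Vec.map ∣_∣ x))

-- Finite subsets of ℤ^d are represented by lists; neither the norm nor the
-- span depends on the order or the multiplicity of the entries.
‖_‖ : ∀ {d} → List (Point d) → ℕ
‖ X ‖ = max 0 (List.map ‖_‖ᵛ X)

-- x is a finite (possibly empty) sum of elements of X ∪ -X.
_∈Span_ : ∀ {d} → Point d → List (Point d) → Set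
x ∈Span X = ∃[ ys ] All (_∈ X ++ List.map -ᵛ_ X) ys × x ≡ sumᵛ ys

data Constraint (d : ℕ) : Set where
  equality   : (α : Point d) (c : ℤ) → Constraint d
  inequality : (α : Point d) (c : ℤ) → Constraint d
  -- Fin m is [0, m-1].
  congruence : (m : ℕ) .{{_ : NonZero m}} (α : Vec (Fin m) d) (c : Fin m) →
               Constraint d

fromResidue : ∀ {m} → Fin m → ℤ
fromResidue i = + toℕ i

_⊨ᶜ_ : ∀ {d} → Point d → Constraint d → Set
x ⊨ᶜ equality α c     = ⟨ α , x ⟩ ≡ c
x ⊨ᶜ inequality α c   = ⟨ α , x ⟩ ℤ.≥ c
x ⊨ᶜ congruence m α c =
  + m ℤ∣.∣ (⟨ Vec.map fromResidue α , x ⟩ ℤ.- fromResidue c)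

data LinearSystem (d : ℕ) : Set where
  atom : Constraint d → LinearSystem d
  ¬ˢ_  : LinearSystem d → LinearSystem d
  _∧ˢ_ : LinearSystem d → LinearSystem d → LinearSystem d
  _∨ˢ_ : LinearSystem d → LinearSystem d → LinearSystem d

_⊨_ : ∀ {d} → Point d → LinearSystem d → Set
x ⊨ atom C   = x ⊨ᶜ C
x ⊨ (¬ˢ S)   = ¬ (x ⊨ S)
x ⊨ (S ∧ˢ T) = (x ⊨ S) × (x ⊨ T)
x ⊨ (S ∨ˢ T) = (x ⊨ S) ⊎ (x ⊨ T)

-- Satisfaction is decidable, so the constructive connectives in _⊨_ agree
-- with the boolean ones.
_⊨ᶜ?_ : ∀ {d} (x : Point d) (C : Constraint d) → Dec (x ⊨ᶜ C)
x ⊨ᶜ? equality α c     = ⟨ α , x ⟩ ℤₚ.≟ c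
x ⊨ᶜ? inequality α c   = c ℤₚ.≤? ⟨ α , x ⟩
x ⊨ᶜ? congruence m α c =
  m ℕ∣.∣? ∣ ⟨ Vec.map fromResidue α , x ⟩ ℤ.- fromResidue c ∣

_⊨?_ : ∀ {d} (x : Point d) (S : LinearSystem d) → Dec (x ⊨ S)
x ⊨? atom C   = x ⊨ᶜ? C
x ⊨? (¬ˢ S)   = ¬? (x ⊨? S)
x ⊨? (S ∧ˢ T) = (x ⊨? S) ×-dec (x ⊨? T)
x ⊨? (S ∨ˢ T) = (x ⊨? S) ⊎-dec (x ⊨? T)

constraints : ∀ {d} → LinearSystem d → List (Constraint d)
constraints (atom C)  = C ∷ []
constraints (¬ˢ S)    = constraints S
constraints (S ∧ˢ T)  = constraints S ++ constraints T
constraints (S ∨ˢ T)  = constraints S ++ constraints T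

-- Congruences do not count towards the norm: they contribute the unit of _⊔_.
‖_‖ᶜ : ∀ {d} → Constraint d → ℕ
‖ equality α c ‖ᶜ     = ‖ α ‖ᵛ ⊔ ∣ c ∣
‖ inequality α c ‖ᶜ   = ‖ α ‖ᵛ ⊔ ∣ c ∣
‖ congruence _ _ _ ‖ᶜ = 0

-- Only congruences have a modulus: the others contribute the unit of lcm.
modulus : ∀ {d} → Constraint d → ℕ
modulus (equality _ _)     = 1
modulus (inequality _ _)   = 1
modulus (congruence m _ _) = m

-- The least s bounding all coefficients and constants of the equalities and
-- inequalities of S.
‖_‖ˢ : ∀ {d} → LinearSystem d → ℕ
‖ S ‖ˢ = max 0 (List.map ‖_‖ᶜ (constraints S))

lcmˢ : ∀ {d} → LinearSystem d → ℕ
lcmˢ S = List.foldr lcm 1 (List.map modulus (constraints S))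

{-# OPTIONS --safe #-}

-- Let D be a nonzero minor, of maximal order, of the matrix whose columns are
-- the elements of X, with columns C and rows I. The minors bordering it by a
-- column x and a row j vanish for x in X, and vanish at a point x for every j
-- exactly when x lies in the rational span of L; for fixed j this is a linear
-- equation in x whose coefficients are minors of order |I|, hence bounded by
-- |I|! ‖X‖^|I|. By Cramer's rule D z ∈ L for every integer point z of that span,
-- so among its integer points L is a union of classes modulo |D|: those of the
-- combinations of X with coefficients in [0, |D| - 1].
module Submission where

open import Defs
open import Data.Bool.Base using (if_then_else_)
open import Data.Fin.Base as Fin using (Fin)
open import Data.Fin.Properties as Finₚ using ()
open import Data.Integer.Base as ℤ using (ℤ; +_; -[1+_]; 0ℤ; 1ℤ; -1ℤ; ∣_∣)
open import Data.Integer.DivMod as ℤ% using (_%ℕ_; _/ℕ_)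
open import Data.Integer.Divisibility.Signed as ℤ∣ using (_∣_; divides)
open import Data.Integer.Properties as ℤₚ using ()
open import Data.Integer.Tactic.RingSolver using (solve-∀)
open import Data.List.Base as List using (List; []; _∷_; _++_; length; upTo; cartesianProductWith)
open import Data.List.Membership.DecPropositional using (_∈?_)
open import Data.List.Membership.Propositional using (_∈_; find; lose)
open import Data.List.Membership.Propositional.Properties as ∈ₚ using ()
open import Data.List.Relation.Binary.Subset.Propositional using (_⊆_)
open import Data.List.Relation.Unary.All as All using (All; []; _∷_)
open import Data.List.Relation.Unary.All.Properties as Allₚ using ()
open import Data.List.Relation.Unary.Any as Any using (Any; here; there)
open import Data.List.Relation.Unary.Any.Properties as Anyₚ using ()
open import Data.Nat.Base as ℕ
  using (ℕ; zero; suc; NonZero; _≤_; _*_; _^_; _⊔_; _!; z≤n; s≤s)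
open import Data.Nat.Divisibility as ℕ∣ using ()
open import Data.Nat.LCM using (lcm; lcm-least)
open import Data.Nat.Properties as ℕₚ using ()
open import Data.List.Extrema ℕₚ.≤-totalOrder using (max≤v⁺; xs≤max)
open import Data.Product.Base using (∃-syntax; _×_; _,_; proj₁)
open import Data.Sum.Base using (inj₁; inj₂)
open import Data.Vec.Base as Vec using ([]; _∷_; lookup; tabulate)
open import Data.Vec.Membership.Propositional.Properties as Vec∈ using ()
open import Data.Vec.Properties as Vecₚ using (lookup∘tabulate)
open import Data.Vec.Relation.Unary.All.Properties as VecAll using ()
open import Function.Base using (_∘_)
open import Function.Bundles using (_⇔_; mk⇔; Equivalence)
open import Relation.Binary.PropositionalEquality
open import Relation.Nullary using (¬_; does; yes; no; contradiction)
open import Relation.Nullary.Decidable using (¬?; decidable-stable)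

private variable
  d : ℕ

-- Minors as alternating forms in their rows

-- The exterior product of the linear form u with the alternating form f; for
-- minors this is the Laplace expansion along the column u.
wedge : (Fin d → ℤ) → (List (Fin d) → ℤ) → List (Fin d) → ℤ
wedge u f []       = 0ℤ
wedge u f (a ∷ as) = u a ℤ.* f as ℤ.- wedge u (f ∘ (a ∷_)) as

-- The rows are an arbitrary list: a row may repeat, and reordering affects the sign. When the
-- numbers of rows and columns differ, the value is 0.
minor : List (Point d) → List (Fin d) → ℤ
minor []      []      = 1ℤ
minor []      (_ ∷ _) = 0ℤ
minor (x ∷ C) = wedge (lookup x) (minor C)

-- Adjacent swaps suffice: two equal neighbours give `f as ≡ - f as`, which forces 0 in the
-- integers.
Alternating : (List (Fin d) → ℤ) → Set
Alternating f = ∀ as a b bs → f (as ++ a ∷ b ∷ bs) ≡ ℤ.- f (as ++ b ∷ a ∷ bs)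

module _ (u : Fin d → ℤ) where

  wedge-neg : ∀ {f g : List (Fin d) → ℤ} → (∀ bs → f bs ≡ ℤ.- g bs) →
              ∀ as → wedge u f as ≡ ℤ.- wedge u g as
  wedge-neg f≡-g []       = refl
  wedge-neg {f} {g} f≡-g (a ∷ as) = trans
    (cong₂ (λ s t → u a ℤ.* s ℤ.- t) (f≡-g as) (wedge-neg (f≡-g ∘ (a ∷_)) as))
    (alg (u a) (g as) (wedge u (g ∘ (a ∷_)) as))
    where
    alg : ∀ x y z → x ℤ.* (ℤ.- y) ℤ.- (ℤ.- z) ≡ ℤ.- (x ℤ.* y ℤ.- z)
    alg = solve-∀

  -- A swap at the head exchanges the two leading terms of the expansion and negates the remainder
  -- because `f` alternates; a later swap is handled by induction.
  wedge-alternating : ∀ {f} → Alternating f → Alternating (wedge u f)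
  wedge-alternating {f} alt [] a b bs = trans
    (cong (λ t → u a ℤ.* f (b ∷ bs) ℤ.- (u b ℤ.* f (a ∷ bs) ℤ.- t))
          (wedge-neg (alt [] a b) bs))
    (alg (u a) (u b) (f (b ∷ bs)) (f (a ∷ bs)) (wedge u (λ cs → f (b ∷ a ∷ cs)) bs))
    where
    alg : ∀ x y p q t → x ℤ.* p ℤ.- (y ℤ.* q ℤ.- (ℤ.- t)) ≡
                        ℤ.- (y ℤ.* q ℤ.- (x ℤ.* p ℤ.- t))
    alg = solve-∀
  wedge-alternating {f} alt (c ∷ as) a b bs = trans
    (cong₂ (λ s t → u c ℤ.* s ℤ.- t) (alt as a b bs)
           (wedge-alternating (alt ∘ (c ∷_)) as a b bs))
    (alg (u c) (f (as ++ b ∷ a ∷ bs)) (wedge u (f ∘ (c ∷_)) (as ++ b ∷ a ∷ bs)))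
    where
    alg : ∀ x y z → x ℤ.* (ℤ.- y) ℤ.- (ℤ.- z) ≡ ℤ.- (x ℤ.* y ℤ.- z)
    alg = solve-∀

minor-alternating : (C : List (Point d)) → Alternating (minor C)
minor-alternating []      []      _ _ _ = refl
minor-alternating []      (_ ∷ _) _ _ _ = refl
minor-alternating (x ∷ C) = wedge-alternating (lookup x) (minor-alternating C)

i≡-i⇒i≡0 : ∀ {i} → i ≡ ℤ.- i → i ≡ 0ℤ
i≡-i⇒i≡0 {+ 0} _ = refl

-- The head is moved to the right by adjacent swaps until it meets its copy.
alternating-∈ : ∀ f → Alternating f → ∀ {a : Fin d} {as} → a ∈ as → f (a ∷ as) ≡ 0ℤ
alternating-∈ f alt {a} (here refl) = i≡-i⇒i≡0 (alt [] a a _)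
alternating-∈ f alt {a} {b ∷ _} (there a∈as) =
  trans (alt [] a b _) (cong ℤ.-_ (alternating-∈ (f ∘ (b ∷_)) (alt ∘ (b ∷_)) a∈as))

alternating-repeat : ∀ f → Alternating f → (as : List (Fin d)) →
                     ∀ {i j} → i Fin.< j → List.lookup as i ≡ List.lookup as j → f as ≡ 0ℤ
alternating-repeat f alt (a ∷ as) {Fin.zero} {Fin.suc j} _ eq =
  alternating-∈ f alt (subst (_∈ as) (sym eq) (∈ₚ.∈-lookup j))
alternating-repeat f alt (a ∷ as) {Fin.suc i} {Fin.suc j} (s≤s i<j) eq =
  alternating-repeat (f ∘ (a ∷_)) (alt ∘ (a ∷_)) as i<j eq

-- By the pigeonhole principle a longer list repeats an entry. Nonzero minors thus have order at
-- most `d`, which limits both the search for a maximal one and the final estimate.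
alternating-length : ∀ {f} → Alternating f → (as : List (Fin d)) →
                     f as ≢ 0ℤ → length as ≤ d
alternating-length {d} alt as f≢0 = ℕₚ.≮⇒≥ λ d<n →
  let i , j , i<j , eq = Finₚ.pigeonhole d<n (List.lookup as)
  in f≢0 (alternating-repeat _ alt as i<j eq)

-- Size of minors

wedge-bound : ∀ (u : Fin d → ℤ) f {N M} → (∀ a → ∣ u a ∣ ≤ N) → ∀ as →
              (∀ bs → suc (length bs) ≡ length as → ∣ f bs ∣ ≤ M) →
              ∣ wedge u f as ∣ ≤ length as * (N * M)
wedge-bound u f u≤N []       f≤M = z≤n
wedge-bound u f {N} {M} u≤N (a ∷ as) f≤M = begin
  ∣ u a ℤ.* f as ℤ.- wedge u (f ∘ (a ∷_)) as ∣
    ≤⟨ ℤₚ.∣i-j∣≤∣i∣+∣j∣ (u a ℤ.* f as) _ ⟩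
  ∣ u a ℤ.* f as ∣ ℕ.+ ∣ wedge u (f ∘ (a ∷_)) as ∣
    ≡⟨ cong (ℕ._+ ∣ wedge u (f ∘ (a ∷_)) as ∣) (ℤₚ.abs-* (u a) (f as)) ⟩
  ∣ u a ∣ * ∣ f as ∣ ℕ.+ ∣ wedge u (f ∘ (a ∷_)) as ∣
    ≤⟨ ℕₚ.+-mono-≤ (ℕₚ.*-mono-≤ (u≤N a) (f≤M as refl))
         (wedge-bound u (f ∘ (a ∷_)) u≤N as λ bs eq → f≤M (a ∷ bs) (cong suc eq)) ⟩
  N * M ℕ.+ length as * (N * M) ∎
  where open ℕₚ.≤-Reasoning

-- Expansion along the first column gives `n` terms, each an entry times a minor of order `n - 1`.
-- The base cases with unequal lengths have value 0.
minor-bound : ∀ {N} {C : List (Point d)} → All (λ x → ∀ i → ∣ lookup x i ∣ ≤ N) C →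
              ∀ as → ∣ minor C as ∣ ≤ length as ! * N ^ length as
minor-bound []          []       = ℕₚ.≤-refl
minor-bound []          (_ ∷ _)  = z≤n
minor-bound (_ ∷ _)     []       = z≤n
minor-bound {N = N} {x ∷ C} (x≤N ∷ C≤N) (a ∷ as) = begin
  ∣ wedge (lookup x) (minor C) (a ∷ as) ∣
    ≤⟨ wedge-bound (lookup x) (minor C) x≤N (a ∷ as) (λ bs eq →
         subst (λ n → ∣ minor C bs ∣ ≤ n ! * N ^ n) (ℕₚ.suc-injective eq) (minor-bound C≤N bs)) ⟩
  suc n * (N * (n ! * N ^ n))  ≡⟨ cong (suc n *_) (ℕₚ.*-assoc N (n !) (N ^ n)) ⟨
  suc n * (N * n ! * N ^ n)    ≡⟨ cong (λ k → suc n * (k * N ^ n)) (ℕₚ.*-comm N (n !)) ⟩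
  suc n * (n ! * N * N ^ n)    ≡⟨ cong (suc n *_) (ℕₚ.*-assoc (n !) N (N ^ n)) ⟩
  suc n * (n ! * (N * N ^ n))  ≡⟨ ℕₚ.*-assoc (suc n) (n !) (N * N ^ n) ⟨
  suc n * n ! * (N * N ^ n)    ∎
  where
  open ℕₚ.≤-Reasoning
  n = length as

-- A nonzero minor that cannot be extended

-- Maximality is local: it concerns only the minors obtained by adding one row and one column. A
-- greedy search provides it, and the equations of the rational span use exactly this.
record MaximalMinor (X : List (Point d)) : Set where
  field
    rows    : List (Fin d)
    columns : List (Point d)
    columns⊆X : All (_∈ X) columns
    nonzero   : minor columns rows ≢ 0ℤ
    maximal   : ∀ j {x} → x ∈ X → minor (x ∷ columns) (j ∷ rows) ≡ 0ℤ

maximalMinor : (X : List (Point d)) → MaximalMinor X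
-- The empty minor is 1. Every extension adds a row, so exhausting `suc d` units of fuel would leave
-- a nonzero minor with more than `d` rows.
maximalMinor {d} X = extend (suc d) [] [] [] (λ ()) (ℕₚ.≤-reflexive (sym (ℕₚ.+-identityʳ _)))
  where
  extend : ∀ fuel (I : List (Fin d)) (C : List (Point d)) → All (_∈ X) C →
           minor C I ≢ 0ℤ → d ℕ.< fuel ℕ.+ length I → MaximalMinor X
  extend zero I C _ ≢0 d<n =
    contradiction (alternating-length (minor-alternating C) I ≢0) (ℕₚ.<⇒≱ d<n)
  extend (suc fuel) I C C⊆X ≢0 d<n
    with Finₚ.any? (λ j → Any.any? (λ x → ¬? (minor (x ∷ C) (j ∷ I) ℤₚ.≟ 0ℤ)) X)
  ... | yes (j , larger) =
    let x , x∈X , ≢0′ = find larger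
    in extend fuel (j ∷ I) (x ∷ C) (x∈X ∷ C⊆X) ≢0′
         (subst (d ℕ.<_) (sym (ℕₚ.+-suc fuel (length I))) d<n)
  ... | no none = record
    { rows      = I
    ; columns   = C
    ; columns⊆X = C⊆X
    ; nonzero   = ≢0
    ; maximal   = λ j x∈X → decidable-stable (_ ℤₚ.≟ 0ℤ) λ ≢0′ → none (j , lose x∈X ≢0′)
    }

-- Bordered minors as linear forms in the new column

δ : Fin d → Fin d → ℤ
δ i a = if does (i Finₚ.≟ a) then 1ℤ else 0ℤ

δ-refl : (a : Fin d) → δ a a ≡ 1ℤ
δ-refl Fin.zero    = refl
δ-refl (Fin.suc a) = δ-refl a

δ-≢ : {i a : Fin d} → i ≢ a → δ i a ≡ 0ℤ
δ-≢ {i = i} {a} i≢a with i Finₚ.≟ a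
... | yes i≡a = contradiction i≡a i≢a
... | no  _   = refl

-- The shape `g i * k - h i` is that of one step in the recursion of `wedge`.
⟨tabulate⟩-linear : ∀ (g h : Fin d → ℤ) k x →
  ⟨ tabulate (λ i → g i ℤ.* k ℤ.- h i) , x ⟩ ≡ ⟨ tabulate g , x ⟩ ℤ.* k ℤ.- ⟨ tabulate h , x ⟩
⟨tabulate⟩-linear g h k []      = refl
⟨tabulate⟩-linear g h k (x ∷ xs) = trans
  (cong (λ t → (g Fin.zero ℤ.* k ℤ.- h Fin.zero) ℤ.* x ℤ.+ t)
        (⟨tabulate⟩-linear (g ∘ Fin.suc) (h ∘ Fin.suc) k xs))
  (alg (g Fin.zero) (h Fin.zero) k x ⟨ tabulate (g ∘ Fin.suc) , xs ⟩ ⟨ tabulate (h ∘ Fin.suc) , xs ⟩)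
  where
  alg : ∀ g h k x s t → (g ℤ.* k ℤ.- h) ℤ.* x ℤ.+ (s ℤ.* k ℤ.- t) ≡
                        (g ℤ.* x ℤ.+ s) ℤ.* k ℤ.- (h ℤ.* x ℤ.+ t)
  alg = solve-∀

⟨0,x⟩≡0 : (x : Point d) → ⟨ tabulate (λ _ → 0ℤ) , x ⟩ ≡ 0ℤ
⟨0,x⟩≡0 []       = refl
⟨0,x⟩≡0 (x ∷ xs) = trans (ℤₚ.+-identityˡ _) (⟨0,x⟩≡0 xs)

⟨δ,x⟩≡xₐ : ∀ (a : Fin d) x → ⟨ tabulate (λ i → δ i a) , x ⟩ ≡ lookup x a
⟨δ,x⟩≡xₐ Fin.zero    (x ∷ xs) = trans
  (cong₂ ℤ._+_ (ℤₚ.*-identityˡ x) (⟨0,x⟩≡0 xs)) (ℤₚ.+-identityʳ x)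
⟨δ,x⟩≡xₐ (Fin.suc a) (x ∷ xs) = trans (ℤₚ.+-identityˡ _) (⟨δ,x⟩≡xₐ a xs)

wedgeForm : (List (Fin d) → ℤ) → List (Fin d) → Point d
wedgeForm f as = tabulate λ i → wedge (δ i) f as

-- Since `wedge u f as` is linear in `u`, its values at the unit vectors `δ i` are its coefficients.
-- This turns a minor bordered by `x` into an equality constraint on `x`.
⟨wedgeForm⟩ : ∀ f as (x : Point d) → ⟨ wedgeForm f as , x ⟩ ≡ wedge (lookup x) f as
⟨wedgeForm⟩ f []       x = ⟨0,x⟩≡0 x
⟨wedgeForm⟩ f (a ∷ as) x = trans
  (⟨tabulate⟩-linear (λ i → δ i a) (λ i → wedge (δ i) (f ∘ (a ∷_)) as) (f as) x)
  (cong₂ (λ s t → s ℤ.* f as ℤ.- t) (⟨δ,x⟩≡xₐ a x) (⟨wedgeForm⟩ (f ∘ (a ∷_)) as x))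

wedge-δ-∉ : ∀ {i : Fin d} f {as} → ¬ i ∈ as → wedge (δ i) f as ≡ 0ℤ
wedge-δ-∉ f {[]}     i∉as = refl
wedge-δ-∉ f {a ∷ as} i∉as = cong₂ (λ s t → s ℤ.* f as ℤ.- t)
  (δ-≢ (i∉as ∘ here)) (wedge-δ-∉ (f ∘ (a ∷_)) (i∉as ∘ there))

-- Alternation makes every coefficient of the linear form a single value of f,
-- up to sign, rather than a sum of such values.
wedge-δ-bound : ∀ (i : Fin d) f → Alternating f → ∀ {M} as →
                (∀ bs → suc (length bs) ≡ length as → ∣ f bs ∣ ≤ M) →
                ∣ wedge (δ i) f as ∣ ≤ M
wedge-δ-bound i f alt []       f≤M = z≤n
wedge-δ-bound i f alt {M} (a ∷ as) f≤M with i Finₚ.≟ a | _∈?_ Finₚ._≟_ i as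
... | yes refl | yes i∈as = subst (λ t → ∣ t ∣ ≤ M) (sym eq) z≤n
  where
  eq : 1ℤ ℤ.* f as ℤ.- wedge (δ i) (f ∘ (i ∷_)) as ≡ 0ℤ
  eq = trans (cong (λ t → t ℤ.* f as ℤ.- wedge (δ i) (f ∘ (i ∷_)) as) (sym (δ-refl i)))
             (alternating-∈ (wedge (δ i) f) (wedge-alternating (δ i) alt) i∈as)
... | yes refl | no i∉as = subst (λ t → ∣ t ∣ ≤ M) (sym eq) (f≤M as refl)
  where
  eq : 1ℤ ℤ.* f as ℤ.- wedge (δ i) (f ∘ (i ∷_)) as ≡ f as
  eq = trans (cong₂ ℤ._-_ (ℤₚ.*-identityˡ (f as)) (wedge-δ-∉ (f ∘ (i ∷_)) i∉as))
             (ℤₚ.+-identityʳ (f as))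
... | no _ | _ = subst (_≤ M)
  (sym (trans (cong ∣_∣ (ℤₚ.+-identityˡ (ℤ.- w))) (ℤₚ.∣-i∣≡∣i∣ w)))
  (wedge-δ-bound i (f ∘ (a ∷_)) (alt ∘ (a ∷_)) as λ bs eq → f≤M (a ∷ bs) (cong suc eq))
  where w = wedge (δ i) (f ∘ (a ∷_)) as

wedge-linear : ∀ k {u v w : Fin d → ℤ} → (∀ i → w i ≡ k ℤ.* u i ℤ.+ v i) → ∀ f as →
               wedge w f as ≡ k ℤ.* wedge u f as ℤ.+ wedge v f as
wedge-linear k {u} {v} {w} w≡ f [] = sym (trans (ℤₚ.+-identityʳ (k ℤ.* 0ℤ)) (ℤₚ.*-zeroʳ k))
wedge-linear k {u} {v} {w} w≡ f (a ∷ as) = trans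
  (cong₂ (λ s t → s ℤ.* f as ℤ.- t) (w≡ a) (wedge-linear k w≡ (f ∘ (a ∷_)) as))
  (alg k (u a) (v a) (f as) (wedge u (f ∘ (a ∷_)) as) (wedge v (f ∘ (a ∷_)) as))
  where
  alg : ∀ k u v p s t → (k ℤ.* u ℤ.+ v) ℤ.* p ℤ.- (k ℤ.* s ℤ.+ t) ≡
                        k ℤ.* (u ℤ.* p ℤ.- s) ℤ.+ (v ℤ.* p ℤ.- t)
  alg = solve-∀

wedge-zero : ∀ {u : Fin d → ℤ} → (∀ i → u i ≡ 0ℤ) → ∀ f as → wedge u f as ≡ 0ℤ
wedge-zero u≡0 f []       = refl
wedge-zero u≡0 f (a ∷ as) =
  cong₂ (λ s t → s ℤ.* f as ℤ.- t) (u≡0 a) (wedge-zero u≡0 (f ∘ (a ∷_)) as)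

-- Integer combinations and the span

infixr 7 _*ᵛ_
_*ᵛ_ : ℤ → Point d → Point d
k *ᵛ x = Vec.map (k ℤ.*_) x

lookup-ext : ∀ {x y : Point d} → (∀ i → lookup x i ≡ lookup y i) → x ≡ y
lookup-ext {x = x} {y} eq = begin
  x                   ≡⟨ Vecₚ.tabulate∘lookup x ⟨
  tabulate (lookup x) ≡⟨ Vecₚ.tabulate-cong eq ⟩
  tabulate (lookup y) ≡⟨ Vecₚ.tabulate∘lookup y ⟩
  y                   ∎
  where open ≡-Reasoning

lookup-0ᵛ : (i : Fin d) → lookup 0ᵛ i ≡ 0ℤ
lookup-0ᵛ i = Vecₚ.lookup-replicate i 0ℤ

lookup-axpy : ∀ k (x y : Point d) i → lookup (k *ᵛ x +ᵛ y) i ≡ k ℤ.* lookup x i ℤ.+ lookup y i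
lookup-axpy k x y i = trans (Vecₚ.lookup-zipWith ℤ._+_ i (k *ᵛ x) y)
  (cong (ℤ._+ lookup y i) (Vecₚ.lookup-map i (k ℤ.*_) x))

-- Arbitrary coefficients replace the signed unit summands of `_∈Span_`, since Cramer's rule and
-- reduction modulo `m` produce coefficients. One generator may occur in several steps.
data Combination {d} (X : List (Point d)) : Point d → Set where
  zero : Combination X 0ᵛ
  step : ∀ k {x y} → x ∈ X → Combination X y → Combination X (k *ᵛ x +ᵛ y)

module _ {X : List (Point d)} where

  -- Closure under scaling and addition at once. The result is described by coordinates, so that
  -- tabulated vectors fit without being rewritten.
  axpy : ∀ k {x y z} → Combination X x → Combination X y →
         (∀ i → lookup z i ≡ k ℤ.* lookup x i ℤ.+ lookup y i) → Combination X z
  axpy k {y = y} {z} zero cy eq = subst (Combination X) (lookup-ext λ i → sym (begin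
    lookup z i                      ≡⟨ eq i ⟩
    k ℤ.* lookup 0ᵛ i ℤ.+ lookup y i ≡⟨ cong (λ t → k ℤ.* t ℤ.+ lookup y i) (lookup-0ᵛ i) ⟩
    k ℤ.* 0ℤ ℤ.+ lookup y i          ≡⟨ cong (ℤ._+ lookup y i) (ℤₚ.*-zeroʳ k) ⟩
    0ℤ ℤ.+ lookup y i                ≡⟨ ℤₚ.+-identityˡ _ ⟩
    lookup y i                      ∎)) cy
    where open ≡-Reasoning
  axpy k {y = y} {z} (step l {x′} {y′} x′∈X cy′) cy eq =
    subst (Combination X) (lookup-ext λ i → begin
      lookup ((k ℤ.* l) *ᵛ x′ +ᵛ (k *ᵛ y′ +ᵛ y)) i
        ≡⟨ lookup-axpy (k ℤ.* l) x′ (k *ᵛ y′ +ᵛ y) i ⟩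
      k ℤ.* l ℤ.* lookup x′ i ℤ.+ lookup (k *ᵛ y′ +ᵛ y) i
        ≡⟨ cong (λ t → k ℤ.* l ℤ.* lookup x′ i ℤ.+ t) (lookup-axpy k y′ y i) ⟩
      k ℤ.* l ℤ.* lookup x′ i ℤ.+ (k ℤ.* lookup y′ i ℤ.+ lookup y i)
        ≡⟨ alg k l (lookup x′ i) (lookup y′ i) (lookup y i) ⟩
      k ℤ.* (l ℤ.* lookup x′ i ℤ.+ lookup y′ i) ℤ.+ lookup y i
        ≡⟨ cong (λ t → k ℤ.* t ℤ.+ lookup y i) (lookup-axpy l x′ y′ i) ⟨
      k ℤ.* lookup (l *ᵛ x′ +ᵛ y′) i ℤ.+ lookup y i
        ≡⟨ eq i ⟨
      lookup z i ∎)
    (step (k ℤ.* l) x′∈X (axpy k cy′ cy (lookup-axpy k y′ y)))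
    where
    open ≡-Reasoning
    alg : ∀ k l x y z → k ℤ.* l ℤ.* x ℤ.+ (k ℤ.* y ℤ.+ z) ≡ k ℤ.* (l ℤ.* x ℤ.+ y) ℤ.+ z
    alg = solve-∀

  scale : ∀ k {x y} → Combination X x → (∀ i → lookup y i ≡ k ℤ.* lookup x i) → Combination X y
  scale k {x} cx eq = axpy k cx zero λ i → trans (eq i)
    (sym (trans (cong (λ t → k ℤ.* lookup x i ℤ.+ t) (lookup-0ᵛ i)) (ℤₚ.+-identityʳ (k ℤ.* lookup x i))))

  generator : ∀ {x} → x ∈ X → Combination X x
  generator {x} x∈X = subst (Combination X) (lookup-ext λ i → begin
    lookup (1ℤ *ᵛ x +ᵛ 0ᵛ) i         ≡⟨ lookup-axpy 1ℤ x 0ᵛ i ⟩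
    1ℤ ℤ.* lookup x i ℤ.+ lookup 0ᵛ i ≡⟨ cong₂ ℤ._+_ (ℤₚ.*-identityˡ (lookup x i)) (lookup-0ᵛ i) ⟩
    lookup x i ℤ.+ 0ℤ                ≡⟨ ℤₚ.+-identityʳ _ ⟩
    lookup x i                       ∎) (step 1ℤ x∈X zero)
    where open ≡-Reasoning

  -- Again the shape of one step of a Laplace expansion, here for whole vectors.
  linear : ∀ k {g h w : Fin d → ℤ} → Combination X (tabulate g) → Combination X (tabulate h) →
           (∀ i → w i ≡ k ℤ.* g i ℤ.- h i) → Combination X (tabulate w)
  linear k {g} {h} {w} cg ch w≡ = axpy k cg (scale -1ℤ {y = tabulate (ℤ.-_ ∘ h)} ch λ i → begin
      lookup (tabulate (ℤ.-_ ∘ h)) i ≡⟨ lookup∘tabulate (ℤ.-_ ∘ h) i ⟩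
      ℤ.- h i                        ≡⟨ ℤₚ.-1*i≡-i (h i) ⟨
      -1ℤ ℤ.* h i                    ≡⟨ cong (-1ℤ ℤ.*_) (lookup∘tabulate h i) ⟨
      -1ℤ ℤ.* lookup (tabulate h) i  ∎) λ i → begin
    lookup (tabulate w) i ≡⟨ lookup∘tabulate w i ⟩
    w i                   ≡⟨ w≡ i ⟩
    k ℤ.* g i ℤ.- h i     ≡⟨ cong₂ (λ s t → k ℤ.* s ℤ.+ t) (lookup∘tabulate g i)
                               (lookup∘tabulate (ℤ.-_ ∘ h) i) ⟨
    k ℤ.* lookup (tabulate g) i ℤ.+ lookup (tabulate (ℤ.-_ ∘ h)) i ∎
    where open ≡-Reasoning

  Span⇒Combination : ∀ {x} → x ∈Span X → Combination X x
  Span⇒Combination (ys , ys⊆ , refl) = sum ys⊆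
    where
    signed : ∀ {y} → y ∈ X ++ List.map -ᵛ_ X → Combination X y
    signed y∈ with ∈ₚ.∈-++⁻ X y∈
    ... | inj₁ y∈X = generator y∈X
    ... | inj₂ y∈-X with x , x∈X , refl ← ∈ₚ.∈-map⁻ -ᵛ_ y∈-X =
      scale -1ℤ (generator x∈X) λ i →
        trans (Vecₚ.lookup-map i ℤ.-_ x) (sym (ℤₚ.-1*i≡-i (lookup x i)))

    sum : ∀ {ys} → All (_∈ X ++ List.map -ᵛ_ X) ys → Combination X (sumᵛ ys)
    sum []                  = zero
    sum {y ∷ ys} (y∈ ∷ ys⊆) = axpy 1ℤ (signed y∈) (sum ys⊆) λ i →
      trans (Vecₚ.lookup-zipWith ℤ._+_ i y (sumᵛ ys))
            (cong (ℤ._+ lookup (sumᵛ ys) i) (sym (ℤₚ.*-identityˡ (lookup y i))))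

  -- Each coefficient `k` is unrolled into `∣ k ∣` summands `x` or `-ᵛ x`, according to its sign.
  Combination⇒Span : ∀ {x} → Combination X x → x ∈Span X
  Combination⇒Span zero = [] , [] , refl
  Combination⇒Span (step k {x} {y} x∈X cy) = repeat k
    where
    open ≡-Reasoning
    cons : ∀ {z w v} → z ∈ X ++ List.map -ᵛ_ X → w ∈Span X →
           (∀ i → lookup v i ≡ lookup z i ℤ.+ lookup w i) → v ∈Span X
    cons {z} z∈ (ys , ys⊆ , refl) eq = z ∷ ys , z∈ ∷ ys⊆ , lookup-ext λ i →
      trans (eq i) (sym (Vecₚ.lookup-zipWith ℤ._+_ i z (sumᵛ ys)))

    alg⁺ : ∀ n x y → (1ℤ ℤ.+ n) ℤ.* x ℤ.+ y ≡ x ℤ.+ (n ℤ.* x ℤ.+ y)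
    alg⁺ = solve-∀

    alg⁻ : ∀ n x y → (-1ℤ ℤ.+ n) ℤ.* x ℤ.+ y ≡ ℤ.- x ℤ.+ (n ℤ.* x ℤ.+ y)
    alg⁻ = solve-∀

    none : 0ℤ *ᵛ x +ᵛ y ∈Span X
    none = subst (_∈Span X) (lookup-ext λ i → begin
      lookup y i                       ≡⟨ ℤₚ.+-identityˡ _ ⟨
      0ℤ ℤ.* lookup x i ℤ.+ lookup y i ≡⟨ lookup-axpy 0ℤ x y i ⟨
      lookup (0ℤ *ᵛ x +ᵛ y) i          ∎) (Combination⇒Span cy)

    repeat⁺ : ∀ n → + n *ᵛ x +ᵛ y ∈Span X
    repeat⁺ zero    = none
    repeat⁺ (suc n) = cons (∈ₚ.∈-++⁺ˡ x∈X) (repeat⁺ n) λ i → begin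
      lookup (+ suc n *ᵛ x +ᵛ y) i
        ≡⟨ lookup-axpy (+ suc n) x y i ⟩
      + suc n ℤ.* lookup x i ℤ.+ lookup y i
        ≡⟨ alg⁺ (+ n) (lookup x i) (lookup y i) ⟩
      lookup x i ℤ.+ (+ n ℤ.* lookup x i ℤ.+ lookup y i)
        ≡⟨ cong (λ t → lookup x i ℤ.+ t) (lookup-axpy (+ n) x y i) ⟨
      lookup x i ℤ.+ lookup (+ n *ᵛ x +ᵛ y) i ∎

    repeat⁻ : ∀ n → (ℤ.- + n) *ᵛ x +ᵛ y ∈Span X
    repeat⁻ zero    = none
    repeat⁻ (suc n) = cons (∈ₚ.∈-++⁺ʳ X (∈ₚ.∈-map⁺ -ᵛ_ x∈X)) (repeat⁻ n) λ i → begin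
      lookup (-[1+ n ] *ᵛ x +ᵛ y) i
        ≡⟨ lookup-axpy -[1+ n ] x y i ⟩
      -[1+ n ] ℤ.* lookup x i ℤ.+ lookup y i
        ≡⟨ cong (λ k → k ℤ.* lookup x i ℤ.+ lookup y i) (ℤₚ.neg-distrib-+ 1ℤ (+ n)) ⟩
      (-1ℤ ℤ.+ ℤ.- + n) ℤ.* lookup x i ℤ.+ lookup y i
        ≡⟨ alg⁻ (ℤ.- + n) (lookup x i) (lookup y i) ⟩
      ℤ.- lookup x i ℤ.+ ((ℤ.- + n) ℤ.* lookup x i ℤ.+ lookup y i)
        ≡⟨ cong₂ ℤ._+_ (Vecₚ.lookup-map i ℤ.-_ x) (lookup-axpy (ℤ.- + n) x y i) ⟨
      lookup (-ᵛ x) i ℤ.+ lookup ((ℤ.- + n) *ᵛ x +ᵛ y) i ∎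

    repeat : ∀ k → k *ᵛ x +ᵛ y ∈Span X
    repeat (+ n)    = repeat⁺ n
    repeat -[1+ n ] = repeat⁻ (suc n)

  -- Cramer's rule over the integers

  wedge-combination : ∀ (u : Fin d → ℤ) (f : Fin d → List (Fin d) → ℤ) →
                      (∀ bs → Combination X (tabulate λ j → f j bs)) →
                      ∀ as → Combination X (tabulate λ j → wedge u (f j) as)
  wedge-combination u f cf [] = scale 0ℤ zero λ i → lookup∘tabulate (λ _ → 0ℤ) i
  wedge-combination u f cf (a ∷ as) = linear (u a) (cf as)
    (wedge-combination u (λ j → f j ∘ (a ∷_)) (cf ∘ (a ∷_)) as) λ _ → refl

  -- With the first row `j` left free, expansion along the first column `x` yields `minor C as`
  -- times the generator `x`, minus an integer combination of the vectors obtained from the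
  -- remaining columns.
  minor-combination : ∀ {C} → All (_∈ X) C → ∀ as → Combination X (tabulate λ j → minor C (j ∷ as))
  minor-combination []          as = scale 0ℤ zero λ i → lookup∘tabulate (λ _ → 0ℤ) i
  minor-combination {x ∷ C} (x∈X ∷ C⊆X) as = linear (minor C as)
    (subst (Combination X) (sym (Vecₚ.tabulate∘lookup x)) (generator x∈X))
    (wedge-combination (lookup x) (λ j → minor C ∘ (j ∷_)) (minor-combination C⊆X) as)
    λ j → cong (ℤ._- wedge (lookup x) (minor C ∘ (j ∷_)) as) (ℤₚ.*-comm (lookup x j) (minor C as))

  -- Cramer's rule: the Laplace expansion of the minors with rows j ∷ as along
  -- their first row, read as a vector indexed by j.
  cramer : ∀ {C} → All (_∈ X) C → ∀ as z → (∀ j → minor (z ∷ C) (j ∷ as) ≡ 0ℤ) →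
           Combination X (minor C as *ᵛ z)
  cramer {C} C⊆X as z vanish = scale 1ℤ
    (wedge-combination (lookup z) (λ j → minor C ∘ (j ∷_)) (minor-combination C⊆X) as)
    λ j → begin
      lookup (D *ᵛ z) j ≡⟨ Vecₚ.lookup-map j (D ℤ.*_) z ⟩
      D ℤ.* lookup z j  ≡⟨ ℤₚ.*-comm D (lookup z j) ⟩
      -- `vanish j` unfolds to `lookup z j * D - w j ≡ 0`: expansion along the column `z`, with `j`
      -- as first row.
      lookup z j ℤ.* D  ≡⟨ ℤₚ.i-j≡0⇒i≡j _ _ (vanish j) ⟩
      w j               ≡⟨ lookup∘tabulate w j ⟨
      lookup (tabulate w) j ≡⟨ ℤₚ.*-identityˡ _ ⟨
      1ℤ ℤ.* lookup (tabulate w) j ∎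
    where
    open ≡-Reasoning
    D = minor C as
    w = λ j → wedge (lookup z) (minor C ∘ (j ∷_)) as

-- Representatives of the combinations modulo `m`

Congruent : ℕ → Point d → Point d → Set
Congruent m x y = ∀ i → + m ∣ lookup x i ℤ.- lookup y i

∣-resp : ∀ {m s t} → s ≡ t → m ∣ s → m ∣ t
∣-resp {m} = subst (m ∣_)

residueCombinations : ℕ → List (Point d) → List (Point d)
residueCombinations m []      = 0ᵛ ∷ []
residueCombinations m (x ∷ X) =
  cartesianProductWith (λ k y → + k *ᵛ x +ᵛ y) (upTo m) (residueCombinations m X)

Combination-⊆ : ∀ {X Y : List (Point d)} → X ⊆ Y → ∀ {x} → Combination X x → Combination Y x
Combination-⊆ X⊆Y zero            = zero
Combination-⊆ X⊆Y (step k x∈X cy) = step k (X⊆Y x∈X) (Combination-⊆ X⊆Y cy)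

residueCombinations-sound : ∀ m (X : List (Point d)) {p} →
                            p ∈ residueCombinations m X → Combination X p
residueCombinations-sound m []      (here refl) = zero
residueCombinations-sound m (x ∷ X) p∈
  with k , q , _ , q∈ , refl ←
         ∈ₚ.∈-cartesianProductWith⁻ (λ k y → + k *ᵛ x +ᵛ y) (upTo m) (residueCombinations m X) p∈
  = step (+ k) (here refl) (Combination-⊆ there (residueCombinations-sound m X q∈))

module _ (m : ℕ) .{{_ : NonZero m}} where

  ∣-%ℕ : ∀ n → + m ∣ n ℤ.- + (n %ℕ m)
  ∣-%ℕ n = divides (n /ℕ m) (begin
    n ℤ.- r                       ≡⟨ cong (ℤ._- r) (ℤ%.a≡a%ℕn+[a/ℕn]*n n m) ⟩
    r ℤ.+ n /ℕ m ℤ.* + m ℤ.- r    ≡⟨ alg r (n /ℕ m ℤ.* + m) ⟩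
    n /ℕ m ℤ.* + m                ∎)
    where
    open ≡-Reasoning
    r = + (n %ℕ m)
    alg : ∀ r s → r ℤ.+ s ℤ.- r ≡ s
    alg = solve-∀

  residue-zero : (X : List (Point d)) → ∃[ p ] p ∈ residueCombinations m X × Congruent m 0ᵛ p
  residue-zero [] = 0ᵛ , here refl , λ i → divides 0ℤ (ℤₚ.i≡j⇒i-j≡0 (refl {x = lookup 0ᵛ i}))
  residue-zero (x ∷ X) with p , p∈ , 0≡p ← residue-zero X =
    0ℤ *ᵛ x +ᵛ p ,
    -- The coefficient 0 is available because `m` is nonzero.
    ∈ₚ.∈-cartesianProductWith⁺ (λ k y → + k *ᵛ x +ᵛ y) (∈ₚ.∈-upTo⁺ (ℕ.>-nonZero⁻¹ m)) p∈ ,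
    λ i → ∣-resp (cong (λ t → lookup 0ᵛ i ℤ.- t) (sym (begin
      lookup (0ℤ *ᵛ x +ᵛ p) i          ≡⟨ lookup-axpy 0ℤ x p i ⟩
      0ℤ ℤ.* lookup x i ℤ.+ lookup p i ≡⟨ ℤₚ.+-identityˡ _ ⟩
      lookup p i                       ∎))) (0≡p i)
    where open ≡-Reasoning

  -- Only the coefficient `l` at the position of `x` changes, to the remainder of `k + l`. The
  -- coefficients before it are kept and cancel in the difference.
  residue-step : ∀ {X : List (Point d)} {x} → x ∈ X → ∀ k {p} → p ∈ residueCombinations m X →
                 ∃[ q ] q ∈ residueCombinations m X × Congruent m (k *ᵛ x +ᵛ p) q
  residue-step {X = z ∷ X} {x} x∈ k p∈ with
    l , p , l∈ , p∈X , refl ←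
      ∈ₚ.∈-cartesianProductWith⁻ (λ k y → + k *ᵛ z +ᵛ y) (upTo m) (residueCombinations m X) p∈
    with x∈
  ... | here refl = + r *ᵛ z +ᵛ p ,
    ∈ₚ.∈-cartesianProductWith⁺ (λ k y → + k *ᵛ z +ᵛ y)
      (∈ₚ.∈-upTo⁺ (ℤ%.n%ℕd<d (k ℤ.+ + l) m)) p∈X ,
    λ i → ∣-resp (begin
      (k ℤ.+ + l ℤ.- + r) ℤ.* lookup z i
        ≡⟨ alg k (+ l) (+ r) (lookup z i) (lookup p i) ⟩
      k ℤ.* lookup z i ℤ.+ (+ l ℤ.* lookup z i ℤ.+ lookup p i)
        ℤ.- (+ r ℤ.* lookup z i ℤ.+ lookup p i)
        ≡⟨ cong₂ (λ s t → k ℤ.* lookup z i ℤ.+ s ℤ.- t)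
             (lookup-axpy (+ l) z p i) (lookup-axpy (+ r) z p i) ⟨
      k ℤ.* lookup z i ℤ.+ lookup (+ l *ᵛ z +ᵛ p) i ℤ.- lookup (+ r *ᵛ z +ᵛ p) i
        ≡⟨ cong (ℤ._- lookup (+ r *ᵛ z +ᵛ p) i) (lookup-axpy k z (+ l *ᵛ z +ᵛ p) i) ⟨
      lookup (k *ᵛ z +ᵛ (+ l *ᵛ z +ᵛ p)) i ℤ.- lookup (+ r *ᵛ z +ᵛ p) i ∎)
    (ℤ∣.∣m⇒∣m*n (lookup z i) (∣-%ℕ (k ℤ.+ + l)))
    where
    open ≡-Reasoning
    r = (k ℤ.+ + l) %ℕ m
    alg : ∀ k l r z p → (k ℤ.+ l ℤ.- r) ℤ.* z ≡ k ℤ.* z ℤ.+ (l ℤ.* z ℤ.+ p) ℤ.- (r ℤ.* z ℤ.+ p)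
    alg = solve-∀
  ... | there x∈X with q , q∈ , kx+p≡q ← residue-step x∈X k p∈X =
    + l *ᵛ z +ᵛ q ,
    ∈ₚ.∈-cartesianProductWith⁺ (λ k y → + k *ᵛ z +ᵛ y) l∈ q∈ ,
    λ i → ∣-resp (begin
      lookup (k *ᵛ x +ᵛ p) i ℤ.- lookup q i
        ≡⟨ cong (ℤ._- lookup q i) (lookup-axpy k x p i) ⟩
      k ℤ.* lookup x i ℤ.+ lookup p i ℤ.- lookup q i
        ≡⟨ alg (k ℤ.* lookup x i) (+ l ℤ.* lookup z i) (lookup p i) (lookup q i) ⟩
      k ℤ.* lookup x i ℤ.+ (+ l ℤ.* lookup z i ℤ.+ lookup p i)
        ℤ.- (+ l ℤ.* lookup z i ℤ.+ lookup q i)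
        ≡⟨ cong₂ (λ s t → k ℤ.* lookup x i ℤ.+ s ℤ.- t)
             (lookup-axpy (+ l) z p i) (lookup-axpy (+ l) z q i) ⟨
      k ℤ.* lookup x i ℤ.+ lookup (+ l *ᵛ z +ᵛ p) i ℤ.- lookup (+ l *ᵛ z +ᵛ q) i
        ≡⟨ cong (ℤ._- lookup (+ l *ᵛ z +ᵛ q) i) (lookup-axpy k x (+ l *ᵛ z +ᵛ p) i) ⟨
      lookup (k *ᵛ x +ᵛ (+ l *ᵛ z +ᵛ p)) i ℤ.- lookup (+ l *ᵛ z +ᵛ q) i ∎)
    (kx+p≡q i)
    where
    open ≡-Reasoning
    alg : ∀ s t p q → s ℤ.+ p ℤ.- q ≡ s ℤ.+ (t ℤ.+ p) ℤ.- (t ℤ.+ q)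
    alg = solve-∀

  -- The tail `y` is replaced by its representative `p`, then `k *ᵛ x +ᵛ p` by `q`; the two errors
  -- add up to a multiple of `m`.
  residueCombinations-complete : ∀ {X : List (Point d)} {x} → Combination X x →
                                 ∃[ p ] p ∈ residueCombinations m X × Congruent m x p
  residueCombinations-complete {X = X} zero = residue-zero X
  residueCombinations-complete (step k {x} {y} x∈X cy)
    with p , p∈ , y≡p ← residueCombinations-complete cy
    with q , q∈ , kx+p≡q ← residue-step x∈X k p∈ =
    q , q∈ , λ i → ∣-resp (begin
      lookup (k *ᵛ x +ᵛ p) i ℤ.- lookup q i ℤ.+ (lookup y i ℤ.- lookup p i)
        ≡⟨ cong (λ t → t ℤ.- lookup q i ℤ.+ (lookup y i ℤ.- lookup p i)) (lookup-axpy k x p i) ⟩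
      k ℤ.* lookup x i ℤ.+ lookup p i ℤ.- lookup q i ℤ.+ (lookup y i ℤ.- lookup p i)
        ≡⟨ alg (k ℤ.* lookup x i) (lookup y i) (lookup p i) (lookup q i) ⟩
      k ℤ.* lookup x i ℤ.+ lookup y i ℤ.- lookup q i
        ≡⟨ cong (ℤ._- lookup q i) (lookup-axpy k x y i) ⟨
      lookup (k *ᵛ x +ᵛ y) i ℤ.- lookup q i ∎)
    (ℤ∣.∣m∣n⇒∣m+n (kx+p≡q i) (y≡p i))
    where
    open ≡-Reasoning
    alg : ∀ s y p q → s ℤ.+ p ℤ.- q ℤ.+ (y ℤ.- p) ≡ s ℤ.+ y ℤ.- q
    alg = solve-∀

  -- Congruence constraints with integer data

  residue : ℤ → Fin m
  residue n = Fin.fromℕ< (ℤ%.n%ℕd<d n m)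

  ∣-residue : ∀ n → + m ∣ n ℤ.- fromResidue (residue n)
  ∣-residue n = ∣-resp (cong (λ r → n ℤ.- + r) (sym (Finₚ.toℕ-fromℕ< (ℤ%.n%ℕd<d n m)))) (∣-%ℕ n)

  ∣-⟨residue⟩ : ∀ (α x : Point d) →
                + m ∣ ⟨ α , x ⟩ ℤ.- ⟨ Vec.map fromResidue (Vec.map residue α) , x ⟩
  ∣-⟨residue⟩ []      []      = divides 0ℤ refl
  ∣-⟨residue⟩ (a ∷ α) (x ∷ xs) = ∣-resp (alg a (fromResidue (residue a)) x ⟨ α , xs ⟩ _)
    (ℤ∣.∣m∣n⇒∣m+n (ℤ∣.∣m⇒∣m*n x (∣-residue a)) (∣-⟨residue⟩ α xs))
    where
    alg : ∀ a b x s t → (a ℤ.- b) ℤ.* x ℤ.+ (s ℤ.- t) ≡ a ℤ.* x ℤ.+ s ℤ.- (b ℤ.* x ℤ.+ t)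
    alg = solve-∀

  reducedCongruence : Point d → ℤ → Constraint d
  reducedCongruence α c = congruence m (Vec.map residue α) (residue c)

  -- Reducing the coefficients and the constant alters `⟨ α , x ⟩ - c` by a multiple of `m`. The
  -- conversions `∣ᵤ⇒∣` and `∣⇒∣ᵤ` pass between divisibility of absolute values, used in `_⊨ᶜ_`, and
  -- signed divisibility.
  reducedCongruence-⇔ : ∀ (α : Point d) c x → x ⊨ᶜ reducedCongruence α c ⇔ + m ∣ ⟨ α , x ⟩ ℤ.- c
  reducedCongruence-⇔ α c x = mk⇔
    (λ m∣ → ∣-resp (alg⁺ s t c c′) (ℤ∣.∣m∣n⇒∣m+n (ℤ∣.∣ᵤ⇒∣ {i = t ℤ.- c′} m∣) difference))
    (λ m∣ → ℤ∣.∣⇒∣ᵤ (∣-resp (alg⁻ s t c c′) (ℤ∣.∣m∣n⇒∣m-n m∣ difference)))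
    where
    s = ⟨ α , x ⟩
    t = ⟨ Vec.map fromResidue (Vec.map residue α) , x ⟩
    c′ = fromResidue (residue c)
    difference : + m ∣ (s ℤ.- t) ℤ.- (c ℤ.- c′)
    difference = ℤ∣.∣m∣n⇒∣m-n (∣-⟨residue⟩ α x) (∣-residue c)
    alg⁺ : ∀ s t c c′ → t ℤ.- c′ ℤ.+ ((s ℤ.- t) ℤ.- (c ℤ.- c′)) ≡ s ℤ.- c
    alg⁺ = solve-∀
    alg⁻ : ∀ s t c c′ → s ℤ.- c ℤ.- ((s ℤ.- t) ℤ.- (c ℤ.- c′)) ≡ t ℤ.- c′
    alg⁻ = solve-∀

-- Finite conjunctions and disjunctions

-- Truth as the equation 0 = 0, which has norm 0 and modulus 1.
⊤ˢ : LinearSystem d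
⊤ˢ = atom (equality (tabulate λ _ → 0ℤ) 0ℤ)

⋀ ⋁ : List (LinearSystem d) → LinearSystem d
⋀ = List.foldr _∧ˢ_ ⊤ˢ
⋁ = List.foldr _∨ˢ_ (¬ˢ ⊤ˢ)

⋀-⇔ : ∀ (Ss : List (LinearSystem d)) x → x ⊨ ⋀ Ss ⇔ All (x ⊨_) Ss
⋀-⇔ Ss x = mk⇔ (to Ss) from
  where
  to : ∀ Ss → x ⊨ ⋀ Ss → All (x ⊨_) Ss
  to []       _          = []
  to (S ∷ Ss) (⊨S , ⊨Ss) = ⊨S ∷ to Ss ⊨Ss

  from : ∀ {Ss} → All (x ⊨_) Ss → x ⊨ ⋀ Ss
  from []         = ⟨0,x⟩≡0 x
  from (⊨S ∷ ⊨Ss) = ⊨S , from ⊨Ss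

⋁-⇔ : ∀ (Ss : List (LinearSystem d)) x → x ⊨ ⋁ Ss ⇔ Any (x ⊨_) Ss
⋁-⇔ Ss x = mk⇔ (to Ss) from
  where
  to : ∀ Ss → x ⊨ ⋁ Ss → Any (x ⊨_) Ss
  to []       ⊨⊥         = contradiction (⟨0,x⟩≡0 x) ⊨⊥
  to (S ∷ Ss) (inj₁ ⊨S)  = here ⊨S
  to (S ∷ Ss) (inj₂ ⊨Ss) = there (to Ss ⊨Ss)

  from : ∀ {Ss} → Any (x ⊨_) Ss → x ⊨ ⋁ Ss
  from (here ⊨S)   = inj₁ ⊨S
  from (there ⊨Ss) = inj₂ (from ⊨Ss)

-- Norm and moduli of a system

‖‖ᵛ-bound : ∀ (x : Point d) {M} → (∀ i → ∣ lookup x i ∣ ≤ M) → ‖ x ‖ᵛ ≤ M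
‖‖ᵛ-bound x x≤M = max≤v⁺ z≤n (VecAll.toList⁺ (VecAll.map⁺ {xs = x} (VecAll.lookup⁻ x≤M)))

∣lookup∣≤‖‖ : ∀ {X : List (Point d)} {x} → x ∈ X → ∀ i → ∣ lookup x i ∣ ≤ ‖ X ‖
∣lookup∣≤‖‖ {X = X} {x} x∈X i = ℕₚ.≤-trans
  (All.lookup (xs≤max 0 (Vec.toList (Vec.map ∣_∣ x)))
    (Vec∈.∈-toList⁺ (Vec∈.∈-map⁺ ∣_∣ (Vec∈.∈-lookup i x))))
  (All.lookup (xs≤max 0 (List.map ‖_‖ᵛ X)) (∈ₚ.∈-map⁺ ‖_‖ᵛ x∈X))

-- Moduli are controlled by divisibility because, unlike an upper bound, it passes to the least
-- common multiple.
record Bounded (M m : ℕ) (S : LinearSystem d) : Set where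
  constructor bounded
  field all : All (λ C → ‖ C ‖ᶜ ≤ M × modulus C ℕ∣.∣ m) (constraints S)

  norm≤ : ‖ S ‖ˢ ≤ M
  norm≤ = max≤v⁺ z≤n (Allₚ.map⁺ (All.map proj₁ all))

  lcm∣ : lcmˢ S ℕ∣.∣ m
  lcm∣ = lcms∣ all
    where
    lcms∣ : ∀ {Cs : List (Constraint d)} → All (λ C → ‖ C ‖ᶜ ≤ M × modulus C ℕ∣.∣ m) Cs →
            List.foldr lcm 1 (List.map modulus Cs) ℕ∣.∣ m
    lcms∣ []               = ℕ∣.1∣ m
    lcms∣ ((_ , ∣m) ∷ ∣ms) = lcm-least ∣m (lcms∣ ∣ms)

module _ {M m : ℕ} where

  equality-bounded : ∀ {α : Point d} → (∀ i → ∣ lookup α i ∣ ≤ M) →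
                     Bounded M m (atom (equality α 0ℤ))
  equality-bounded {α = α} α≤M = bounded ((ℕₚ.⊔-lub (‖‖ᵛ-bound α α≤M) z≤n , ℕ∣.1∣ m) ∷ [])

  ⊤ˢ-bounded : Bounded M m (⊤ˢ {d})
  ⊤ˢ-bounded = equality-bounded λ i →
    subst (λ t → ∣ t ∣ ≤ M) (sym (lookup∘tabulate (λ _ → 0ℤ) i)) z≤n

  ⋀-bounded : ∀ {Ss : List (LinearSystem d)} → All (Bounded M m) Ss → Bounded M m (⋀ Ss)
  ⋀-bounded []                = ⊤ˢ-bounded
  ⋀-bounded (bounded b ∷ bs) = bounded (Allₚ.++⁺ b (Bounded.all (⋀-bounded bs)))

  ⋁-bounded : ∀ {Ss : List (LinearSystem d)} → All (Bounded M m) Ss → Bounded M m (⋁ Ss)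
  -- Negation keeps the list of constraints, so the bound for `⊤ˢ` carries over to its negation.
  ⋁-bounded []                = bounded (Bounded.all ⊤ˢ-bounded)
  ⋁-bounded (bounded b ∷ bs) = bounded (Allₚ.++⁺ b (Bounded.all (⋁-bounded bs)))

-- The system of the span and its bound

!-mono-≤ : ∀ {m n} → m ≤ n → m ! ≤ n !
!-mono-≤ {n = n} m≤n = ℕ∣.∣⇒≤ {{n ℕₚ.!≢0}} (ℕ∣.m≤n⇒m!∣n! m≤n)

-- For positive `N` both factors grow with `r`. For `N` = 0 the left side is 0 unless `r` = 0, when
-- it is the empty minor's 1; this case calls for `1 ⊔`.
r!*N^r≤1⊔d!*N^d : ∀ N {r d} → r ≤ d → r ! * N ^ r ≤ 1 ⊔ d ! * N ^ d
r!*N^r≤1⊔d!*N^d zero {zero} {d}      r≤d = ℕₚ.m≤m⊔n 1 (d ! * 0 ^ d)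
r!*N^r≤1⊔d!*N^d zero {r@(suc _)} {d} r≤d = subst (_≤ 1 ⊔ d ! * 0 ^ d) (sym (ℕₚ.*-zeroʳ (r !))) z≤n
r!*N^r≤1⊔d!*N^d N@(suc _) {d = d} r≤d = ℕₚ.≤-trans
  (ℕₚ.*-mono-≤ (!-mono-≤ r≤d) (ℕₚ.^-monoʳ-≤ N r≤d)) (ℕₚ.m≤n⊔m 1 (d ! * N ^ d))

-- If `d` is positive and `X` has no nonzero vector, `d ! * ‖ X ‖ ^ d` is 0, while a least common
-- multiple of moduli is at least 1; hence `1 ⊔`. In every other case that product is itself at
-- least 1.
theorem3 : (d : ℕ) (X : List (Point d)) →
    ∃[ S ] (∀ (x : Point d) → x ⊨ S ⇔ x ∈Span X) ×
    ‖ S ‖ˢ ⊔ lcmˢ S ≤ 1 ⊔ d ! * ‖ X ‖ ^ d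
theorem3 d X = S , (λ x → mk⇔ (Combination⇒Span ∘ sound x) (complete x ∘ Span⇒Combination)) ,
  ℕₚ.⊔-lub (Bounded.norm≤ S-bounded)
    (ℕₚ.≤-trans (ℕ∣.∣⇒≤ (Bounded.lcm∣ S-bounded)) (minor≤M rows ℕₚ.≤-refl))
  where
  open MaximalMinor (maximalMinor X)
  open ≡-Reasoning

  M = 1 ⊔ d ! * ‖ X ‖ ^ d
  D = minor columns rows
  m = ∣ D ∣

  -- `ℤ.NonZero D` unfolds to `NonZero ∣ D ∣`, so one instance serves for the modulus `m` and for
  -- cancelling `D`.
  instance
    D≢0 : ℤ.NonZero D
    D≢0 = ℤ.≢-nonZero nonzero

  -- Used twice: for `D` itself, which bounds the moduli, and for the coefficients of the equations.
  minor≤M : ∀ as → length as ≤ length rows → ∣ minor columns as ∣ ≤ M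
  minor≤M as as≤rows = ℕₚ.≤-trans (minor-bound (All.map ∣lookup∣≤‖‖ columns⊆X) as)
    (r!*N^r≤1⊔d!*N^d ‖ X ‖ (ℕₚ.≤-trans as≤rows
      (alternating-length {f = minor columns} (minor-alternating columns) rows nonzero)))

  E : Fin d → Point d → ℤ
  E j x = minor (x ∷ columns) (j ∷ rows)

  vanishing : Fin d → LinearSystem d
  vanishing j = atom (equality (wedgeForm (minor columns) (j ∷ rows)) 0ℤ)

  -- Even the coefficients 0 and 1 go through reduction: when `m` is 1, the only residue is 0.
  coordinate : Point d → Fin d → LinearSystem d
  coordinate p i = atom (reducedCongruence m (tabulate λ a → δ a i) (lookup p i))

  class : Point d → LinearSystem d
  class p = ⋀ (List.tabulate (coordinate p))

  classes = residueCombinations m X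

  S = ⋀ (List.tabulate vanishing) ∧ˢ ⋁ (List.map class classes)

  class-⇔ : ∀ x p → x ⊨ class p ⇔ Congruent m x p
  class-⇔ x p = mk⇔
    (λ ⊨p i → ∣-resp (cong (ℤ._- lookup p i) (⟨δ,x⟩≡xₐ i x))
      (Equivalence.to (reducedCongruence-⇔ m (tabulate λ a → δ a i) (lookup p i) x)
        (Allₚ.tabulate⁻ (Equivalence.to (⋀-⇔ (List.tabulate (coordinate p)) x) ⊨p) i)))
    (λ x≡p → Equivalence.from (⋀-⇔ (List.tabulate (coordinate p)) x) (Allₚ.tabulate⁺ λ i →
      Equivalence.from (reducedCongruence-⇔ m (tabulate λ a → δ a i) (lookup p i) x)
        (∣-resp (cong (ℤ._- lookup p i) (sym (⟨δ,x⟩≡xₐ i x))) (x≡p i))))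

  -- `E j` is linear in the point and vanishes on `X` by maximality of the minor.
  E-vanishes : ∀ {x} → Combination X x → ∀ j → E j x ≡ 0ℤ
  E-vanishes zero j = wedge-zero lookup-0ᵛ (minor columns) (j ∷ rows)
  E-vanishes (step k {x} {y} x∈X cy) j = begin
    E j (k *ᵛ x +ᵛ y)       ≡⟨ wedge-linear k (lookup-axpy k x y) (minor columns) (j ∷ rows) ⟩
    k ℤ.* E j x ℤ.+ E j y   ≡⟨ cong₂ (λ s t → k ℤ.* s ℤ.+ t) (maximal j x∈X) (E-vanishes cy j) ⟩
    k ℤ.* 0ℤ ℤ.+ 0ℤ         ≡⟨ ℤₚ.+-identityʳ _ ⟩
    k ℤ.* 0ℤ                ≡⟨ ℤₚ.*-zeroʳ k ⟩
    0ℤ                      ∎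

  complete : ∀ x → Combination X x → x ⊨ S
  complete x cx with p , p∈ , x≡p ← residueCombinations-complete m cx =
    Equivalence.from (⋀-⇔ (List.tabulate vanishing) x) (Allₚ.tabulate⁺ λ j →
      trans (⟨wedgeForm⟩ (minor columns) (j ∷ rows) x) (E-vanishes cx j)) ,
    Equivalence.from (⋁-⇔ (List.map class classes) x)
      (Anyₚ.map⁺ (lose p∈ (Equivalence.from (class-⇔ x p) x≡p)))

  -- If x ≡ p mod D and E vanishes at x, then z = (x - p) / D is an integer
  -- point where E vanishes, so x - p = D z is a combination by Cramer's rule.
  sound : ∀ x → x ⊨ S → Combination X x
  sound x (⊨E , ⊨classes)
    with p , p∈ , ⊨p ← find (Anyₚ.map⁻ (Equivalence.to (⋁-⇔ (List.map class classes) x) ⊨classes)) =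
    axpy 1ℤ (cramer columns⊆X rows z E-z) cp λ i → begin
      lookup x i                                ≡⟨ x≡Dz+p i ⟩
      D ℤ.* q i ℤ.+ lookup p i                  ≡⟨ cong (λ t → D ℤ.* t ℤ.+ lookup p i) (lookup∘tabulate q i) ⟨
      D ℤ.* lookup z i ℤ.+ lookup p i           ≡⟨ cong (ℤ._+ lookup p i) (Vecₚ.lookup-map i (D ℤ.*_) z) ⟨
      lookup (D *ᵛ z) i ℤ.+ lookup p i          ≡⟨ cong (ℤ._+ lookup p i) (ℤₚ.*-identityˡ (lookup (D *ᵛ z) i)) ⟨
      1ℤ ℤ.* lookup (D *ᵛ z) i ℤ.+ lookup p i   ∎
    where
    cp : Combination X p
    cp = residueCombinations-sound m X p∈

    D∣x-p : ∀ i → D ∣ lookup x i ℤ.- lookup p i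
    -- The class fixes `x` modulo `∣ D ∣`; passing to `D` puts its sign into the quotient.
    D∣x-p i = ℤ∣.∣-trans ℤ∣.m∣∣m∣ (Equivalence.to (class-⇔ x p) ⊨p i)

    q : Fin d → ℤ
    q i = ℤ∣.quotient (D∣x-p i)

    z = tabulate q

    alg : ∀ x p → x ≡ x ℤ.- p ℤ.+ p
    alg = solve-∀

    x≡Dz+p : ∀ i → lookup x i ≡ D ℤ.* q i ℤ.+ lookup p i
    x≡Dz+p i = begin
      lookup x i                                  ≡⟨ alg (lookup x i) (lookup p i) ⟩
      lookup x i ℤ.- lookup p i ℤ.+ lookup p i    ≡⟨ cong (ℤ._+ lookup p i) (_∣_.equality (D∣x-p i)) ⟩
      q i ℤ.* D ℤ.+ lookup p i                    ≡⟨ cong (ℤ._+ lookup p i) (ℤₚ.*-comm (q i) D) ⟩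
      D ℤ.* q i ℤ.+ lookup p i                    ∎

    E-z : ∀ j → E j z ≡ 0ℤ
    -- Linearity gives `D * E j z + E j p ≡ E j x`. Here `E j p` vanishes because `p` is a
    -- combination, and `E j x` by the equations in `S`; then `D` cancels.
    E-z j = ℤₚ.*-cancelˡ-≡ D (E j z) 0ℤ (begin
      D ℤ.* E j z               ≡⟨ ℤₚ.+-identityʳ _ ⟨
      D ℤ.* E j z ℤ.+ 0ℤ        ≡⟨ cong (λ t → D ℤ.* E j z ℤ.+ t) (E-vanishes cp j) ⟨
      D ℤ.* E j z ℤ.+ E j p     ≡⟨ wedge-linear D (λ i → trans (x≡Dz+p i)
                                     (cong (λ t → D ℤ.* t ℤ.+ lookup p i) (sym (lookup∘tabulate q i))))
                                     (minor columns) (j ∷ rows) ⟨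
      E j x                     ≡⟨ ⟨wedgeForm⟩ (minor columns) (j ∷ rows) x ⟨
      ⟨ wedgeForm (minor columns) (j ∷ rows) , x ⟩
        ≡⟨ Allₚ.tabulate⁻ (Equivalence.to (⋀-⇔ (List.tabulate vanishing) x) ⊨E) j ⟩
      0ℤ                        ≡⟨ ℤₚ.*-zeroʳ D ⟨
      D ℤ.* 0ℤ                  ∎)

  S-bounded : Bounded M m S
  S-bounded = bounded (Allₚ.++⁺
    (Bounded.all (⋀-bounded (Allₚ.tabulate⁺ vanishing-bounded)))
    (Bounded.all (⋁-bounded (Allₚ.map⁺ (All.universal class-bounded classes)))))
    where
    vanishing-bounded : ∀ j → Bounded M m (vanishing j)
    vanishing-bounded j = equality-bounded λ i → subst (λ t → ∣ t ∣ ≤ M)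
      (sym (lookup∘tabulate (λ i → wedge (δ i) (minor columns) (j ∷ rows)) i))
      -- Each coefficient is 0 or, up to sign, one minor with as many rows as `D`, so the bound of
      -- that order applies without an extra factor.
      (wedge-δ-bound i (minor columns) (minor-alternating columns) (j ∷ rows)
        λ bs eq → minor≤M bs (ℕₚ.≤-reflexive (ℕₚ.suc-injective eq)))

    class-bounded : ∀ p → Bounded M m (class p)
    class-bounded p = ⋀-bounded (Allₚ.tabulate⁺ {f = coordinate p} λ i →
      bounded ((z≤n , ℕ∣.∣-refl) ∷ []))
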